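{- Let $q\ge 3$ be a prime such that $p=\frac{q-1}{2}$ is odd. Then the minimum order $n\!\left[\frac{p+1}{2},q;6\right]$ of a $\left[\frac{p+1}{2},q;6\right]$-mixed graph satisfies $$n\!\left[\tfrac{p+1}{2},\,q;\,6\right]\le 4q^2 .$$
   Context: A mixed graph $G=(V;E\cup A)$ has a finite vertex set $V$, a set $E$ of (undirected) edges $uv$ and a set $A$ of arcs $(u,v)$; it is simple: no parallel arcs, no parallel edges, and no arc parallel to an edge. Walks, paths and cycles are sequences of vertices in which each consecutive pair $v_i,v_{i+1}$ is joined by the arc $(v_i,v_{i+1})$ or by the edge $v_iv_{i+1}$ (arcs are traversed in their direction, edges in either direction; a cycle is closed, has no repeated vertices, and traversing a single edge back and forth is not a cycle). The girth is the length of a shortest cycle. A $[z,r;g]$-mixed graph is a mixed graph in which every vertex has exactly $z$ in-arcs, $z$ out-arcs and $r$ edges, and whose girth is $g$. The order of a graph is its number of vertices; $n[z,r;g]$ denotes the minimum order of a $[z,r;g]$-mixed graph, and a $[z,r;g]$-mixed cage is a $[z,r;g]$-mixed graph of that order. -}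

module Defs where

open import Data.Bool using (Bool; T)
open import Data.Fin using (Fin; zero; suc; inject₁; fromℕ)
open import Data.Fin.Subset using (∣_∣)
open import Data.Nat using (ℕ; suc; _≤_)
open import Data.Product using (∃; _×_)
open import Data.Sum using (_⊎_)
open import Data.Vec using (tabulate)
open import Function.Base using (_∘_)
open import Function.Definitions using (Injective)
open import Relation.Binary.PropositionalEquality using (_≡_; _≢_)
open import Relation.Nullary using (¬_)

-- Boolean adjacency already rules out parallel arcs and parallel edges.
-- Opposite arcs (u,v), (v,u) are not parallel; they form a cycle of length 2.
record MixedGraph (n : ℕ) : Set where
  field
    arc           : Fin n → Fin n → Bool
    edge          : Fin n → Fin n → Bool
    arc-loopless  : ∀ u → ¬ T (arc u u)
    edge-loopless : ∀ u → ¬ T (edge u u)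
    edge-sym      : ∀ u v → T (edge u v) → T (edge v u)
    arc-edge      : ∀ u v → T (arc u v) → ¬ T (edge u v)

  Joined : Fin n → Fin n → Set
  Joined u v = T (arc u v) ⊎ T (edge u v)

  outdegree indegree edgedegree : Fin n → ℕ
  outdegree  u = ∣ tabulate (λ v → arc u v) ∣
  indegree   u = ∣ tabulate (λ v → arc v u) ∣
  edgedegree u = ∣ tabulate (λ v → edge u v) ∣

-- A cycle of length k is a sequence v₀, v₁, …, vₖ = v₀ with v₀, …, vₖ₋₁ distinct.
record Cycle {n : ℕ} (G : MixedGraph n) (k : ℕ) : Set where
  open MixedGraph G
  field
    length≥1 : 1 ≤ k
    vertex   : Fin (suc k) → Fin n
    closed   : vertex (fromℕ k) ≡ vertex zero
    distinct : Injective _≡_ _≡_ (vertex ∘ inject₁)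
    joined   : ∀ i → Joined (vertex (inject₁ i)) (vertex (suc i))
    -- No arc is parallel to an edge, so a closed walk v₀, v₁, v₀ that uses an
    -- edge traverses this single edge back and forth.
    no-back-and-forth :
      ∀ i → T (edge (vertex (inject₁ i)) (vertex (suc i))) → k ≢ 2

HasGirth : ∀ {n} → MixedGraph n → ℕ → Set
HasGirth G g = Cycle G g × (∀ k → Cycle G k → g ≤ k)

record Is[_,_⨾_]-MixedGraph (z r g : ℕ) {n : ℕ} (G : MixedGraph n) : Set where
  open MixedGraph G
  field
    indegree≡z   : ∀ v → indegree v ≡ z
    outdegree≡z  : ∀ v → outdegree v ≡ z
    edgedegree≡r : ∀ v → edgedegree v ≡ r
    girth≡g      : HasGirth G g

IsOrder[_,_⨾_] : ℕ → ℕ → ℕ → ℕ → Set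
IsOrder[ z , r ⨾ g ] n = ∃ λ (G : MixedGraph n) → Is[ z , r ⨾ g ]-MixedGraph G

-- n = n[z,r;g].  The minimum is a relation because it is undefined when no
-- [z,r;g]-mixed graph exists.
IsMinimumOrder[_,_⨾_] : ℕ → ℕ → ℕ → ℕ → Set
IsMinimumOrder[ z , r ⨾ g ] n =
  IsOrder[ z , r ⨾ g ] n × (∀ m → IsOrder[ z , r ⨾ g ] m → n ≤ m)

{-# OPTIONS --safe #-}
module Submission where

open import Data.Bool using (Bool; true; false; not; T)
open import Data.Bool.Properties using (T?)
import Data.Bool.Properties as Bool
open import Data.Fin using (Fin; zero; suc; inject₁; fromℕ; fromℕ<; toℕ; combine; remQuot; finToFun; funToFin)
open import Data.Fin.Induction using (<-weakInduction)
open import Data.Fin.Properties using (_≟_; all?; any?; toℕ<n; toℕ-injective; toℕ-fromℕ; toℕ-fromℕ<; toℕ-inject₁; injective⇒≤; suc-injective; remQuot-combine; finToFun-funToFin; 2↔Bool; *↔×)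
open import Data.Fin.Subset using (Subset; ∣_∣)
open import Data.Fin.Subset.Properties using (anySubset?)
open import Data.Integer using (ℤ; +_; -_; _-_)
import Data.Integer as ℤ
open import Data.Integer.Divisibility.Signed using (divides; _∣?_; ∣ᵤ⇒∣; ∣⇒∣ᵤ; ∣m∣n⇒∣m+n; ∣m∣n⇒∣m-n; ∣m⇒∣-m; ∣m⇒∣m*n; ∣-trans; *-cancelˡ-∣) renaming (_∣_ to _∣ℤ_)
open import Data.Integer.DivMod using (_/ℕ_; _%ℕ_; n%ℕd<d; a≡a%ℕn+[a/ℕn]*n)
import Data.Integer.Properties as ℤ
open import Data.Integer.Tactic.RingSolver using (solve-∀)
open import Data.Nat using (ℕ; zero; suc; _+_; _*_; _∸_; _^_; _/_; _%_; _⊔_; _≤_; _<_; _≥_; z≤n; s≤s; s≤s⁻¹; NonZero; >-nonZero⁻¹)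
open import Data.Nat.Divisibility using (_∣_; >⇒∤)
import Data.Nat.Divisibility as ℕ
open import Data.Nat.DivMod using (m%n<n; m≡m%n+[m/n]*n; m*n/n≡m)
open import Data.Nat.Induction using (<-rec)
open import Data.Nat.Primality using (Prime; euclidsLemma; prime⇒nonZero; prime⇒irreducible)
open import Data.Nat.Properties using (_≤?_; anyUpTo?; allUpTo?; ≤-trans; ≤-refl; ≮⇒≥; <⇒≤; <⇒≱)
import Data.Nat.Properties as ℕ
import Data.Nat.Tactic.RingSolver as ℕ
open import Data.Product using (∃; _×_; _,_; proj₁; proj₂; uncurry)
open import Data.Product.Function.NonDependent.Propositional using (_×-↔_)
open import Data.Sum as Sum using (_⊎_; inj₁; inj₂)
open import Data.Vec using (tabulate; lookup)
open import Data.Vec.Properties using (lookup∘tabulate; tabulate-cong)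
open import Function.Base using (_∘_)
open import Function.Bundles using (_↔_; Inverse)
open import Function.Construct.Composition using (_↔-∘_)
open import Function.Definitions using (Injective)
open import Level using (0ℓ)
open import Relation.Binary using (Rel; Decidable; Symmetric; tri<; tri≈; tri>)
open import Relation.Binary.PropositionalEquality
open import Relation.Nullary using (¬_; Dec; yes; no; contradiction)
open import Relation.Nullary.Decidable using (map′; _×-dec_; _⊎-dec_; _→-dec_; ¬?; isYes; toWitness; fromWitness; from-no)
import Relation.Unary as U
open import Defs

-- Two copies of the incidence graph of the biaffine plane over ℤ/q are glued
-- along arcs.  Vertices are points (x, y) and lines [m, b] with x, m ∈ ℤ/q and
-- y, b ∈ ℤ/2q; the edges are the incidences y = 2xm + b, and with q = 4c + 3
-- the arcs run from (x, y) to (x, y + s) and from [m, b] to [m, b + s] for the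
-- odd s ∈ {1, 3, …, 2c + 1}.  An edge changes the type (point or line) and
-- keeps the parity of the last coordinate, an arc does the opposite, so all
-- cycles are even.  Lengths 2 and 4 are excluded: a sum of at most four of the
-- s lies strictly between 0 and 2q, a line has one point over each x, two lines
-- share at most one point (q is prime), and a cycle arc, edge, arc, edge would
-- give s + s′ = 0.  Since 2q = 4(2c + 1) + 1 + 1, six arcs do close up.
--
-- The minimum order exists constructively because being the order of a
-- [z,r;g]-mixed graph is decidable by exhaustive search.

-- Exhaustive search for the minimum order

least : ∀ {P : ℕ → Set} → U.Decidable P → ∀ N → P N →
        ∃ λ n → (P n × (∀ m → P m → n ≤ m)) × n ≤ N
least {P} P? = <-rec _ search
  where
  -- Descent: whenever a smaller number satisfies `P` the search restarts from it; otherwise `N`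
  -- itself is minimal.
  search : ∀ N → (∀ {m} → m < N → P m → ∃ λ n → (P n × (∀ k → P k → n ≤ k)) × n ≤ m) →
           P N → ∃ λ n → (P n × (∀ k → P k → n ≤ k)) × n ≤ N
  search N rec PN with anyUpTo? P? N
  ... | no ∄ = N , (PN , λ k Pk → ≮⇒≥ λ k<N → ∄ (k , k<N , Pk)) , ≤-refl
  ... | yes (m , m<N , Pm) with rec m<N Pm
  ...   | n , minimal , n≤m = n , minimal , ≤-trans n≤m (<⇒≤ m<N)

module _ {n : ℕ} where

  infix 4 _≈_
  -- Without function extensionality, a graph rebuilt from its adjacency matrices agrees with the
  -- original only pointwise, and its proof fields may differ. Properties are therefore transported
  -- along this relation instead of equality.
  record _≈_ (G H : MixedGraph n) : Set where
    private
      module G = MixedGraph G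
      module H = MixedGraph H
    field
      arc≗  : ∀ u v → G.arc u v ≡ H.arc u v
      edge≗ : ∀ u v → G.edge u v ≡ H.edge u v

  Cycle-resp : ∀ {G H k} → G ≈ H → Cycle G k → Cycle H k
  Cycle-resp G≈H C = record
    { length≥1          = length≥1
    ; vertex            = vertex
    ; closed            = closed
    ; distinct          = distinct
    ; joined            = λ i → Sum.map (subst T (arc≗ _ _)) (subst T (edge≗ _ _)) (joined i)
    ; no-back-and-forth = λ i e → no-back-and-forth i (subst T (sym (edge≗ _ _)) e)
    }
    where
    open _≈_ G≈H
    open Cycle C

  ≈-sym : ∀ {G H} → G ≈ H → H ≈ G
  ≈-sym G≈H = record { arc≗ = λ u v → sym (arc≗ u v) ; edge≗ = λ u v → sym (edge≗ u v) }
    where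
    open _≈_ G≈H

  IsMixedGraph-resp : ∀ {z r g G H} → G ≈ H → Is[ z , r ⨾ g ]-MixedGraph G → Is[ z , r ⨾ g ]-MixedGraph H
  IsMixedGraph-resp G≈H isG = record
    { indegree≡z   = λ v → trans (cong ∣_∣ (tabulate-cong λ u → sym (arc≗ u v))) (indegree≡z v)
    ; outdegree≡z  = λ v → trans (cong ∣_∣ (tabulate-cong λ u → sym (arc≗ v u))) (outdegree≡z v)
    ; edgedegree≡r = λ v → trans (cong ∣_∣ (tabulate-cong λ u → sym (edge≗ v u))) (edgedegree≡r v)
    ; girth≡g      = let C , shortest = girth≡g in
                     Cycle-resp G≈H C , λ k D → shortest k (Cycle-resp (≈-sym G≈H) D)
    }
    where
    open _≈_ G≈H
    open Is[_,_⨾_]-MixedGraph isG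

  module _ (G : MixedGraph n) where
    open MixedGraph G

    -- Separates the vertex sequence of a cycle from the conditions on it: for a fixed sequence
    -- these are decidable, and the sequences themselves are coded by the finite type
    -- `Fin (n ^ suc k)`.
    CycleThrough : ∀ k → (Fin (suc k) → Fin n) → Set
    CycleThrough k v =
      1 ≤ k ×
      v (fromℕ k) ≡ v zero ×
      (∀ i j → v (inject₁ i) ≡ v (inject₁ j) → i ≡ j) ×
      (∀ i → Joined (v (inject₁ i)) (v (suc i))) ×
      (∀ i → T (edge (v (inject₁ i)) (v (suc i))) → k ≢ 2)

    cycleThrough? : ∀ k → U.Decidable (CycleThrough k)
    cycleThrough? k v =
      (1 ≤? k) ×-dec
      (v (fromℕ k) ≟ v zero) ×-dec
      (all? λ i → all? λ j → (v (inject₁ i) ≟ v (inject₁ j)) →-dec (i ≟ j)) ×-dec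
      (all? λ i → T? (arc (v (inject₁ i)) (v (suc i))) ⊎-dec T? (edge (v (inject₁ i)) (v (suc i)))) ×-dec
      (all? λ i → T? (edge (v (inject₁ i)) (v (suc i))) →-dec ¬? (k ℕ.≟ 2))

    CycleThrough-resp : ∀ {k v w} → v ≗ w → CycleThrough k v → CycleThrough k w
    CycleThrough-resp v≗w (k≥1 , cl , dis , joi , nbf) =
      k≥1 ,
      trans (sym (v≗w _)) (trans cl (v≗w _)) ,
      (λ i j eq → dis i j (trans (v≗w _) (trans eq (sym (v≗w _))))) ,
      (λ i → subst₂ Joined (v≗w _) (v≗w _) (joi i)) ,
      (λ i e → nbf i (subst₂ (λ u u′ → T (edge u u′)) (sym (v≗w _)) (sym (v≗w _)) e))

    cycle? : U.Decidable (Cycle G)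
    cycle? k = map′ toCycle fromCycle (any? λ i → cycleThrough? k (finToFun i))
      where
      toCycle : (∃ λ i → CycleThrough k (finToFun i)) → Cycle G k
      toCycle (i , k≥1 , cl , dis , joi , nbf) = record
        { length≥1 = k≥1 ; vertex = finToFun i ; closed = cl ; distinct = dis _ _
        ; joined = joi ; no-back-and-forth = nbf }

      fromCycle : Cycle G k → ∃ λ i → CycleThrough k (finToFun i)
      fromCycle C = funToFin vertex , CycleThrough-resp (λ i → sym (finToFun-funToFin vertex i))
        (length≥1 , closed , (λ _ _ → distinct) , joined , no-back-and-forth)
        where
        open Cycle C

    -- The condition on all lengths amounts to the absence of cycles of the finitely many lengths
    -- below `g`, each of which can be tested.
    hasGirth? : U.Decidable (HasGirth G)
    hasGirth? g = cycle? g ×-dec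
      map′ {A = ∀ {k} → k < g → ¬ Cycle G k}
           (λ none k C → ≮⇒≥ λ k<g → none k<g C) (λ g≤ k<g C → <⇒≱ k<g (g≤ _ C))
           (allUpTo? (λ k → ¬? (cycle? k)) g)

    isMixedGraph? : ∀ z r g → Dec (Is[ z , r ⨾ g ]-MixedGraph G)
    isMixedGraph? z r g = map′
      (λ (i , o , e , h) → record
        { indegree≡z = i ; outdegree≡z = o ; edgedegree≡r = e ; girth≡g = h })
      (λ isG → indegree≡z isG , outdegree≡z isG , edgedegree≡r isG , girth≡g isG)
      ((all? λ v → indegree v ℕ.≟ z) ×-dec
       (all? λ v → outdegree v ℕ.≟ z) ×-dec
       (all? λ v → edgedegree v ℕ.≟ r) ×-dec
       hasGirth? g)
      where
      open Is[_,_⨾_]-MixedGraph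

  -- A relation on `Fin n` is coded as a set of `n * n` positions, the form that `anySubset?` can
  -- search.
  matrix : Subset (n * n) → Fin n → Fin n → Bool
  matrix s u v = lookup s (combine u v)

  entries : (Fin n → Fin n → Bool) → Subset (n * n)
  entries f = tabulate (uncurry f ∘ remQuot n)

  matrix-entries : ∀ f u v → matrix (entries f) u v ≡ f u v
  matrix-entries f u v = trans (lookup∘tabulate _ (combine u v)) (cong (uncurry f) (remQuot-combine u v))

  Simple : (arc edge : Fin n → Fin n → Bool) → Set
  Simple arc edge =
    (∀ u → ¬ T (arc u u)) ×
    (∀ u → ¬ T (edge u u)) ×
    (∀ u v → T (edge u v) → T (edge v u)) ×
    (∀ u v → T (arc u v) → ¬ T (edge u v))

  simple? : ∀ arc edge → Dec (Simple arc edge)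
  simple? arc edge =
    (all? λ u → ¬? (T? (arc u u))) ×-dec
    (all? λ u → ¬? (T? (edge u u))) ×-dec
    (all? λ u → all? λ v → T? (edge u v) →-dec T? (edge v u)) ×-dec
    (all? λ u → all? λ v → T? (arc u v) →-dec ¬? (T? (edge u v)))

  graph : ∀ {arc edge} → Simple arc edge → MixedGraph n
  graph {arc} {edge} (al , el , es , ae) = record
    { arc = arc ; edge = edge ; arc-loopless = al ; edge-loopless = el
    ; edge-sym = es ; arc-edge = ae }

  anyMixedGraph? : ∀ {P : MixedGraph n → Set} → (∀ {G H} → G ≈ H → P G → P H) →
                   U.Decidable P → Dec (∃ P)
  anyMixedGraph? {P} resp P? =
    map′ (λ (_ , _ , s , PG) → graph s , PG) encode
         (anySubset? λ a → anySubset? λ e → decide (matrix a) (matrix e))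
    where
    decide : ∀ arc edge → Dec (∃ λ (s : Simple arc edge) → P (graph s))
    decide arc edge with simple? arc edge
    ... | no ¬s = no λ (s , _) → ¬s s
    -- Two proofs of `Simple` need not be equal; `resp` lets the single proof `s` decide for all of
    -- them.
    ... | yes s = map′ (s ,_) (λ (_ , PG) → resp (record { arc≗ = λ _ _ → refl ; edge≗ = λ _ _ → refl }) PG)
                       (P? (graph s))

    encode : ∃ P → ∃ λ a → ∃ λ e → ∃ λ (s : Simple (matrix a) (matrix e)) → P (graph s)
    encode (G , PG) = entries arc , entries edge , s ,
      resp (record { arc≗ = λ u v → sym (matrix-entries arc u v) ; edge≗ = λ u v → sym (matrix-entries edge u v) }) PG
      where
      open MixedGraph G

      to : ∀ {f u v} → T (matrix (entries f) u v) → T (f u v)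
      to {f} = subst T (matrix-entries f _ _)

      from : ∀ {f u v} → T (f u v) → T (matrix (entries f) u v)
      from {f} = subst T (sym (matrix-entries f _ _))

      s : Simple (matrix (entries arc)) (matrix (entries edge))
      s = (λ u → arc-loopless u ∘ to {arc}) ,
          (λ u → edge-loopless u ∘ to {edge}) ,
          (λ u v → from {edge} ∘ edge-sym u v ∘ to {edge}) ,
          (λ u v a e → arc-edge u v (to {arc} a) (to {edge} e))

isOrder? : ∀ z r g → U.Decidable IsOrder[ z , r ⨾ g ]
isOrder? z r g n = anyMixedGraph? IsMixedGraph-resp λ G → isMixedGraph? G z r g

minimumOrder : ∀ {z r g} N → IsOrder[ z , r ⨾ g ] N → ∃ λ n → IsMinimumOrder[ z , r ⨾ g ] n × n ≤ N
minimumOrder {z} {r} {g} = least (isOrder? z r g)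

-- Counting by enumeration

record Enumerates {A : Set} (P : A → Set) {k : ℕ} (g : Fin k → A) : Set where
  field
    injective  : Injective _≡_ _≡_ g
    sound      : ∀ i → P (g i)
    exhaustive : ∀ {a} → P a → ∃ λ i → g i ≡ a

-- Sending each entry of `g` to its index in `h` is injective, and an injection between finite types
-- bounds their sizes.
enumeration-≤ : ∀ {A : Set} {P : A → Set} {k l} {g : Fin k → A} {h : Fin l → A} →
                Enumerates P g → Enumerates P h → k ≤ l
enumeration-≤ {g = g} {h} G H = injective⇒≤ {f = λ i → proj₁ (index i)} λ {i} {j} eq →
  G.injective (trans (sym (proj₂ (index i))) (trans (cong h eq) (proj₂ (index j))))
  where
  module G = Enumerates G
  module H = Enumerates H

  index : ∀ i → ∃ λ j → h j ≡ g i
  index i = H.exhaustive (G.sound i)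

enumerate : ∀ {n} (f : Fin n → Bool) →
            ∃ λ (g : Fin ∣ tabulate f ∣ → Fin n) → Enumerates (T ∘ f) g
enumerate {zero}  f = (λ ()) , record { injective = λ {} ; sound = λ () ; exhaustive = λ {} }
enumerate {suc n} f with f zero in f0 | enumerate (f ∘ suc)
... | false | g , G = suc ∘ g , record
  { injective  = λ eq → injective (suc-injective eq)
  ; sound      = sound
  ; exhaustive = λ { {zero} p → contradiction (subst T f0 p) (λ ())
                   ; {suc v} p → let i , eq = exhaustive p in i , cong suc eq }
  }
  where
  open Enumerates G
... | true  | g , G = g⁺ , record
  { injective  = λ { {zero} {zero} _ → refl
                   ; {suc i} {suc j} eq → cong suc (injective (suc-injective eq)) }
  ; sound      = λ { zero → subst T (sym f0) _ ; (suc i) → sound i }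
  ; exhaustive = λ { {zero} p → zero , refl
                   ; {suc v} p → let i , eq = exhaustive p in suc i , cong suc eq }
  }
  where
  open Enumerates G
  g⁺ : Fin (suc ∣ tabulate (f ∘ suc) ∣) → Fin (suc n)
  g⁺ zero    = zero
  g⁺ (suc i) = suc (g i)

-- `enumerate` lists the true positions with the cardinality as length, and two enumerations of one
-- predicate bound each other. Degrees are thereby read off from explicit lists of neighbours.
∣tabulate∣ : ∀ {n k} {f : Fin n → Bool} {g : Fin k → Fin n} →
             Enumerates (T ∘ f) g → ∣ tabulate f ∣ ≡ k
∣tabulate∣ {f = f} G = let _ , F = enumerate f in
  ℕ.≤-antisym (enumeration-≤ F G) (enumeration-≤ G F)

module _ {A : Set} {n : ℕ} (iso : Fin n ↔ A) where
  open Inverse iso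

  ∣tabulate∣-↔ : ∀ {P : A → Set} (P? : U.Decidable P) {k} {g : Fin k → A} →
                 Enumerates P g → ∣ tabulate (λ i → isYes (P? (to i))) ∣ ≡ k
  ∣tabulate∣-↔ {P} P? {g = g} G = ∣tabulate∣ {g = from ∘ g} record
    { injective  = λ eq → injective (trans (sym (strictlyInverseˡ _)) (trans (cong to eq) (strictlyInverseˡ _)))
    ; sound      = λ i → fromWitness (subst P (sym (strictlyInverseˡ _)) (sound i))
    ; exhaustive = λ {v} p → let i , eq = exhaustive (toWitness p) in
                   i , trans (cong from eq) (strictlyInverseʳ v)
    }
    where
    open Enumerates G

-- Congruences and residues

∣-resp : ∀ {d a b} → a ≡ b → d ∣ℤ a → d ∣ℤ b
∣-resp {d} = subst (d ∣ℤ_)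

0<m<n⇒n∤m : ∀ {m n} → 0 < m → m < n → ¬ (+ n ∣ℤ + m)
0<m<n⇒n∤m {suc m} _ m<n n∣m = >⇒∤ m<n (∣⇒∣ᵤ n∣m)

-- The distance of `a` and `b` is at most their maximum, hence below `n`, and the only such multiple
-- of `n` is 0.
∣-diff⇒≡ : ∀ {n a b} → a < n → b < n → + n ∣ℤ + a - + b → a ≡ b
∣-diff⇒≡ {n} {a} {b} a<n b<n n∣a-b =
  ℤ.+-injective (ℤ.i-j≡0⇒i≡j (+ a) (+ b) (ℤ.∣i∣≡0⇒i≡0 (small (∣⇒∣ᵤ n∣a-b) bound)))
  where
  bound : ℤ.∣ + a - + b ∣ < n
  bound = ℕ.≤-<-trans (subst (λ i → ℤ.∣ i ∣ ≤ a ⊔ b) (sym (ℤ.m-n≡m⊖n a b)) (ℤ.∣m⊝n∣≤m⊔n a b)) (ℕ.⊔-lub a<n b<n)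

  small : ∀ {m} → n ℕ.∣ m → m < n → m ≡ 0
  small {zero}  _   _   = refl
  small {suc m} n∣m m<n = contradiction n∣m (>⇒∤ m<n)

module _ (n : ℕ) {{_ : NonZero n}} where
  -- Opaque so that type checking does not unfold integer division; all later arguments go through
  -- the congruence `residue-≡`.
  opaque
    residue : ℤ → Fin n
    residue a = fromℕ< (n%ℕd<d a n)

    residue-≡ : ∀ a → + n ∣ℤ + toℕ (residue a) - a
    residue-≡ a = divides (- (a /ℕ n)) (begin
      + toℕ (residue a) - a
        ≡⟨ cong₂ (λ i b → + i - b) (toℕ-fromℕ< (n%ℕd<d a n)) (a≡a%ℕn+[a/ℕn]*n a n) ⟩
      + (a %ℕ n) - (+ (a %ℕ n) ℤ.+ a /ℕ n ℤ.* + n)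
        ≡⟨ lemma (+ (a %ℕ n)) (a /ℕ n) (+ n) ⟩
      - (a /ℕ n) ℤ.* + n ∎)
      where
      open ≡-Reasoning
      lemma : ∀ r k m → r - (r ℤ.+ k ℤ.* m) ≡ - k ℤ.* m
      lemma = solve-∀

  residue-unique : ∀ {a} {i : Fin n} → + n ∣ℤ + toℕ i - a → residue a ≡ i
  residue-unique {a} {i} n∣i-a = toℕ-injective (∣-diff⇒≡ (toℕ<n _) (toℕ<n _)
    (∣-resp (lemma (+ toℕ (residue a)) (+ toℕ i) a) (∣m∣n⇒∣m-n (residue-≡ a) n∣i-a)))
    where
    lemma : ∀ r i a → (r - a) - (i - a) ≡ r - i
    lemma = solve-∀

  residue-injective : ∀ {a b} → residue a ≡ residue b → + n ∣ℤ a - b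
  residue-injective {a} {b} eq =
    ∣-resp (lemma (+ toℕ (residue b)) a b)
      (∣m∣n⇒∣m-n (residue-≡ b) (subst (λ r → + n ∣ℤ + toℕ r - a) eq (residue-≡ a)))
    where
    lemma : ∀ r a b → (r - b) - (r - a) ≡ a - b
    lemma = solve-∀

strictlyMono : ∀ {f : ℕ → ℕ} → (∀ k → f k < f (suc k)) → ∀ {k l} → k < l → f k < f l
strictlyMono {f} step {k} {suc l} (s≤s k≤l) with ℕ.m≤n⇒m<n∨m≡n k≤l
... | inj₁ k<l  = ℕ.<-trans (strictlyMono step k<l) (step l)
... | inj₂ refl = step k

strictlyMono⇒injective : ∀ {f : ℕ → ℕ} → (∀ k → f k < f (suc k)) → ∀ {k l} → f k ≡ f l → k ≡ l
strictlyMono⇒injective step {k} {l} eq with ℕ.<-cmp k l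
... | tri< k<l _ _ = contradiction eq (ℕ.<⇒≢ (strictlyMono step k<l))
... | tri≈ _ k≡l _ = k≡l
... | tri> _ _ l<k = contradiction (sym eq) (ℕ.<⇒≢ (strictlyMono step l<k))

-- Points, lines and their neighbours

module Construction (q c : ℕ) (q≡3+4c : q ≡ 3 + 4 * c) (q-prime : Prime q) where

  N : ℕ
  N = 2 * q

  instance
    q≢0 : NonZero q
    q≢0 = prime⇒nonZero q-prime

    N≢0 : NonZero N
    N≢0 = ℕ.m*n≢0 2 q

  step : Fin (suc c) → ℕ
  step i = 1 + 2 * toℕ i

  step≤ : ∀ i → step i ≤ 1 + 2 * c
  step≤ i = s≤s (ℕ.*-monoʳ-≤ 2 (s≤s⁻¹ (toℕ<n i)))

  N≡ : N ≡ (1 + 2 * c) + (1 + 2 * c) + (1 + 2 * c) + (1 + 2 * c) + 1 + 1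
  N≡ = trans (cong (2 *_) q≡3+4c) (lemma c)
    where
    lemma : ∀ c → 2 * (3 + 4 * c) ≡ (1 + 2 * c) + (1 + 2 * c) + (1 + 2 * c) + (1 + 2 * c) + 1 + 1
    lemma = ℕ.solve-∀

  -- Four longest steps fall short of `N` by exactly 2. The bounds for fewer steps follow by padding
  -- the sum with further steps.
  step⁴<N : ∀ i j k l → step i + step j + step k + step l < N
  step⁴<N i j k l = ℕ.≤-<-trans
    (ℕ.+-mono-≤ (ℕ.+-mono-≤ (ℕ.+-mono-≤ (step≤ i) (step≤ j)) (step≤ k)) (step≤ l))
    (subst (M <_) (sym (trans N≡ (ℕ.+-assoc M 1 1))) (ℕ.m<m+n M (s≤s z≤n)))
    where
    M : ℕ
    M = (1 + 2 * c) + (1 + 2 * c) + (1 + 2 * c) + (1 + 2 * c)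

  step²<N : ∀ i j → step i + step j < N
  step²<N i j = ℕ.≤-<-trans (ℕ.≤-trans (ℕ.m≤m+n _ (step i)) (ℕ.m≤m+n _ (step i))) (step⁴<N i j i i)

  step<N : ∀ i → step i < N
  step<N i = ℕ.≤-<-trans (ℕ.m≤m+n _ (step i)) (step²<N i i)

  step-injective : ∀ {i j} → + N ∣ℤ + step i - + step j → i ≡ j
  step-injective {i} {j} N∣ = toℕ-injective (ℕ.*-cancelˡ-≡ _ _ 2 (ℕ.suc-injective
    (∣-diff⇒≡ (step<N i) (step<N j) N∣)))

  -- (false, x, y) is the point (x, y) and (true, m, b) is the line [m, b].
  V : Set
  V = Bool × Fin q × Fin N

  side : V → Bool
  side = proj₁

  abscissa : V → ℤ
  abscissa (_ , x , _) = + toℕ x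

  -- With lines carrying the height −b, the incidence y = 2xm + b becomes the
  -- symmetric condition that the two heights add up to 2xm.
  sign : Bool → ℤ → ℤ
  sign false a = a
  sign true  a = - a

  height : V → ℤ
  height (t , _ , y) = sign t (+ toℕ y)

  A : Rel V 0ℓ
  A (t , x , y) (t′ , x′ , y′) =
    t ≡ t′ × x ≡ x′ × ∃ λ i → + N ∣ℤ + toℕ y′ - (+ toℕ y ℤ.+ + step i)

  -- The factor 2 makes the product of two abscissas modulo `q` well defined modulo `N`, and it lets
  -- edges preserve the parity of the last coordinate.
  E : Rel V 0ℓ
  E u v = side v ≡ not (side u) × + N ∣ℤ height u ℤ.+ height v - + 2 ℤ.* (abscissa u ℤ.* abscissa v)

  A? : Decidable A
  A? (t , x , y) (t′ , x′ , y′) =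
    (t Bool.≟ t′) ×-dec (x ≟ x′) ×-dec any? λ i → + N ∣? (+ toℕ y′ - (+ toℕ y ℤ.+ + step i))

  E? : Decidable E
  E? u v = (side v Bool.≟ not (side u)) ×-dec (+ N ∣? (height u ℤ.+ height v - + 2 ℤ.* (abscissa u ℤ.* abscissa v)))

  E-sym : Symmetric E
  E-sym {u} {v} (t , N∣) =
    trans (sym (Bool.not-involutive (side u))) (cong not (sym t)) ,
    ∣-resp (lemma (height u) (height v) (abscissa u) (abscissa v)) N∣
    where
    lemma : ∀ a b x m → a ℤ.+ b - + 2 ℤ.* (x ℤ.* m) ≡ b ℤ.+ a - + 2 ℤ.* (m ℤ.* x)
    lemma = solve-∀

  A-irrefl : ∀ u → ¬ A u u
  A-irrefl (_ , _ , y) (_ , _ , i , N∣) = 0<m<n⇒n∤m (s≤s z≤n) (step<N i)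
    (∣-resp (lemma (+ toℕ y) (+ step i)) (∣m⇒∣-m N∣))
    where
    lemma : ∀ y s → - (y - (y ℤ.+ s)) ≡ s
    lemma = solve-∀

  E-irrefl : ∀ u → ¬ E u u
  E-irrefl u (t , _) = Bool.not-¬ refl t

  A⇒¬E : ∀ {u v} → A u v → ¬ E u v
  A⇒¬E (refl , _) (t , _) = Bool.not-¬ refl t

  outNeighbour : V → Fin (suc c) → V
  outNeighbour (t , x , y) i = t , x , residue N (+ toℕ y ℤ.+ + step i)

  inNeighbour : V → Fin (suc c) → V
  inNeighbour (t , x , y) i = t , x , residue N (+ toℕ y - + step i)

  -- The incidence solved for the last coordinate on the other side: `b = y - 2xm` from a point and
  -- `y = b + 2xm` from a line, both covered by `sign t`. Each abscissa thus carries one neighbour.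
  edgeNeighbour : V → Fin q → V
  edgeNeighbour (t , x , y) m = not t , m , residue N (+ toℕ y - sign t (+ 2 ℤ.* (+ toℕ x ℤ.* + toℕ m)))

  outNeighbours : ∀ u → Enumerates (A u) (outNeighbour u)
  outNeighbours u@(t , x , y) = record
    { injective  = λ {i} {j} eq → step-injective (∣-resp (lemma (+ toℕ y) (+ step i) (+ step j))
                     (residue-injective N (cong (proj₂ ∘ proj₂) eq)))
    ; sound      = λ i → refl , refl , i , residue-≡ N (+ toℕ y ℤ.+ + step i)
    ; exhaustive = λ { (refl , refl , i , N∣) → i , cong (λ y → t , x , y) (residue-unique N N∣) }
    }
    where
    lemma : ∀ y s s′ → (y ℤ.+ s) - (y ℤ.+ s′) ≡ s - s′
    lemma = solve-∀

  inNeighbours : ∀ u → Enumerates (λ v → A v u) (inNeighbour u)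
  inNeighbours u@(t , x , y) = record
    { injective  = λ {i} {j} eq → sym (step-injective (∣-resp (lemma₁ (+ toℕ y) (+ step i) (+ step j))
                     (residue-injective N (cong (proj₂ ∘ proj₂) eq))))
    ; sound      = λ i → refl , refl , i ,
                     ∣-resp (lemma₂ (+ toℕ (residue N (+ toℕ y - + step i))) (+ toℕ y) (+ step i))
                            (∣m⇒∣-m (residue-≡ N (+ toℕ y - + step i)))
    ; exhaustive = λ { {_ , _ , y′} (refl , refl , i , N∣) → i , cong (λ y → t , x , y) (residue-unique N
                     (∣-resp (lemma₃ (+ toℕ y′) (+ toℕ y) (+ step i)) (∣m⇒∣-m N∣))) }
    }
    where
    lemma₁ : ∀ y s s′ → (y - s) - (y - s′) ≡ s′ - s
    lemma₁ = solve-∀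

    lemma₂ : ∀ r y s → - (r - (y - s)) ≡ y - (r ℤ.+ s)
    lemma₂ = solve-∀

    lemma₃ : ∀ r y s → - (y - (r ℤ.+ s)) ≡ r - (y - s)
    lemma₃ = solve-∀

  edgeNeighbours : ∀ u → Enumerates (E u) (edgeNeighbour u)
  edgeNeighbours (t , x , y) = record
    { injective  = cong (proj₁ ∘ proj₂)
    ; sound      = λ m → refl , incident t m _ (residue-≡ N (+ toℕ y - sign t (+ 2 ℤ.* (+ toℕ x ℤ.* + toℕ m))))
    ; exhaustive = λ { {_ , m , b} (refl , N∣) → m , cong (λ b → not t , m , b) (residue-unique N (offset t m b N∣)) }
    }
    where
    lemma₁ : ∀ b y k → - (b - (y - k)) ≡ y ℤ.+ - b - k
    lemma₁ = solve-∀

    lemma₂ : ∀ b y k → b - (y - - k) ≡ - y ℤ.+ b - k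
    lemma₂ = solve-∀

    lemma₃ : ∀ b y k → - (y ℤ.+ - b - k) ≡ b - (y - k)
    lemma₃ = solve-∀

    incident : ∀ t m (b : Fin N) → + N ∣ℤ + toℕ b - (+ toℕ y - sign t (+ 2 ℤ.* (+ toℕ x ℤ.* + toℕ m))) →
               + N ∣ℤ sign t (+ toℕ y) ℤ.+ sign (not t) (+ toℕ b) - + 2 ℤ.* (+ toℕ x ℤ.* + toℕ m)
    incident false m b N∣ = ∣-resp (lemma₁ (+ toℕ b) (+ toℕ y) (+ 2 ℤ.* (+ toℕ x ℤ.* + toℕ m))) (∣m⇒∣-m N∣)
    incident true  m b N∣ = ∣-resp (lemma₂ (+ toℕ b) (+ toℕ y) (+ 2 ℤ.* (+ toℕ x ℤ.* + toℕ m))) N∣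

    offset : ∀ t m (b : Fin N) →
             + N ∣ℤ sign t (+ toℕ y) ℤ.+ sign (not t) (+ toℕ b) - + 2 ℤ.* (+ toℕ x ℤ.* + toℕ m) →
             + N ∣ℤ + toℕ b - (+ toℕ y - sign t (+ 2 ℤ.* (+ toℕ x ℤ.* + toℕ m)))
    offset false m b N∣ = ∣-resp (lemma₃ (+ toℕ b) (+ toℕ y) (+ 2 ℤ.* (+ toℕ x ℤ.* + toℕ m))) (∣m⇒∣-m N∣)
    offset true  m b N∣ = ∣-resp (sym (lemma₂ (+ toℕ b) (+ toℕ y) (+ 2 ℤ.* (+ toℕ x ℤ.* + toℕ m)))) N∣

  -- Closed walks of length 2 and 4

  no-AA : ∀ {u v} → A u v → ¬ A v u
  no-AA {_ , _ , y} {_ , _ , y′} (_ , _ , i , N∣₁) (_ , _ , j , N∣₂) =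
    0<m<n⇒n∤m (s≤s z≤n) (step²<N i j)
      (∣-resp (lemma (+ toℕ y) (+ toℕ y′) (+ step i) (+ step j)) (∣m⇒∣-m (∣m∣n⇒∣m+n N∣₁ N∣₂)))
    where
    lemma : ∀ y y′ s s′ → - ((y′ - (y ℤ.+ s)) ℤ.+ (y - (y′ ℤ.+ s′))) ≡ s ℤ.+ s′
    lemma = solve-∀

  -- As in `no-AA`, the last coordinates telescope around the walk, so `N` would divide a sum of
  -- steps that lies strictly between 0 and `N`.
  no-AAAA : ∀ {u v w x} → A u v → A v w → A w x → ¬ A x u
  no-AAAA {_ , _ , a} {_ , _ , b} {_ , _ , c} {_ , _ , d}
          (_ , _ , i , N∣₁) (_ , _ , j , N∣₂) (_ , _ , k , N∣₃) (_ , _ , l , N∣₄) =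
    0<m<n⇒n∤m (s≤s z≤n) (step⁴<N i j k l)
      (∣-resp (lemma (+ toℕ a) (+ toℕ b) (+ toℕ c) (+ toℕ d) (+ step i) (+ step j) (+ step k) (+ step l))
        (∣m⇒∣-m (∣m∣n⇒∣m+n (∣m∣n⇒∣m+n (∣m∣n⇒∣m+n N∣₁ N∣₂) N∣₃) N∣₄)))
    where
    lemma : ∀ a b c d i j k l →
            - ((b - (a ℤ.+ i)) ℤ.+ (c - (b ℤ.+ j)) ℤ.+ (d - (c ℤ.+ k)) ℤ.+ (a - (d ℤ.+ l))) ≡ i ℤ.+ j ℤ.+ k ℤ.+ l
    lemma = solve-∀

  height-injective : ∀ {u v} → side u ≡ side v → abscissa u ≡ abscissa v → + N ∣ℤ height u - height v → u ≡ v
  height-injective {false , _ , y} {_ , _ , y′} refl x≡ N∣ =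
    cong₂ (λ x y → false , x , y) (toℕ-injective (ℤ.+-injective x≡))
      (toℕ-injective (∣-diff⇒≡ (toℕ<n y) (toℕ<n y′) N∣))
  height-injective {true , _ , y} {_ , _ , y′} refl x≡ N∣ =
    cong₂ (λ x y → true , x , y) (toℕ-injective (ℤ.+-injective x≡))
      (toℕ-injective (∣-diff⇒≡ (toℕ<n y) (toℕ<n y′) (∣-resp (lemma (+ toℕ y) (+ toℕ y′)) (∣m⇒∣-m N∣))))
    where
    lemma : ∀ y y′ → - (- y - - y′) ≡ y - y′
    lemma = solve-∀

  -- Subtracting the incidences cancels the height of `l` and, the abscissas being equal, the
  -- products; so the heights of `u` and `w` agree modulo `N`.
  neighbour-unique : ∀ {l u w} → E l u → E l w → abscissa u ≡ abscissa w → u ≡ w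
  neighbour-unique {l} {u} {w} (t₁ , N∣₁) (t₂ , N∣₂) x≡ =
    height-injective (trans t₁ (sym t₂)) x≡
      (∣-resp (lemma (height l) (height u) (height w) (+ 2 ℤ.* (abscissa l ℤ.* abscissa w)))
        (∣m∣n⇒∣m-n (subst (λ x → + N ∣ℤ height l ℤ.+ height u - + 2 ℤ.* (abscissa l ℤ.* x)) x≡ N∣₁) N∣₂))
    where
    lemma : ∀ l u w p → (l ℤ.+ u - p) - (l ℤ.+ w - p) ≡ u - w
    lemma = solve-∀

  A⇒abscissa≡ : ∀ {u v} → A u v → abscissa u ≡ abscissa v
  A⇒abscissa≡ (_ , x≡ , _) = cong (λ x → + toℕ x) x≡

  -- Arcs keep the abscissa, so `u` and `w` are neighbours of `x` over the same abscissa.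
  AAEE⇒≡ : ∀ {u v w x} → A u v → A v w → E w x → E x u → u ≡ w
  AAEE⇒≡ {u} {v} {w} {x} a b e f = neighbour-unique {x} f (E-sym {w} {x} e)
    (trans (A⇒abscissa≡ {u} {v} a) (A⇒abscissa≡ {v} {w} b))

  -- Both edges join the abscissas `p` and `m`, so the products cancel when their incidences are
  -- subtracted. One arc leads from the edge `xu` to the edge `vw` and the other leads back, so the
  -- two steps add up instead of cancelling, and `N` would divide their sum.
  no-AEAE : ∀ {u v w x} → A u v → E v w → A w x → ¬ E x u
  no-AEAE {false , p , a} {_ , _ , b} {_ , m , c} {_ , _ , d}
          (refl , refl , i , N∣₁) (refl , N∣₂) (refl , refl , j , N∣₃) (_ , N∣₄) =
    0<m<n⇒n∤m (s≤s z≤n) (step²<N i j)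
      (∣-resp (lemma (+ toℕ a) (+ toℕ b) (+ toℕ c) (+ toℕ d) (+ step i) (+ step j) (+ toℕ p) (+ toℕ m))
        (∣m∣n⇒∣m-n (∣m∣n⇒∣m-n (∣m∣n⇒∣m-n N∣₂ N∣₄) N∣₁) N∣₃))
    where
    lemma : ∀ a b c d i j p m →
            (b ℤ.+ - c - + 2 ℤ.* (p ℤ.* m)) - (- d ℤ.+ a - + 2 ℤ.* (m ℤ.* p))
              - (b - (a ℤ.+ i)) - (d - (c ℤ.+ j)) ≡ i ℤ.+ j
    lemma = solve-∀
  -- With points and lines exchanged the heights change sign, so the incidences are subtracted in
  -- the opposite order.
  no-AEAE {true , p , a} {_ , _ , b} {_ , m , c} {_ , _ , d}
          (refl , refl , i , N∣₁) (refl , N∣₂) (refl , refl , j , N∣₃) (_ , N∣₄) =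
    0<m<n⇒n∤m (s≤s z≤n) (step²<N i j)
      (∣-resp (lemma (+ toℕ a) (+ toℕ b) (+ toℕ c) (+ toℕ d) (+ step i) (+ step j) (+ toℕ p) (+ toℕ m))
        (∣m∣n⇒∣m-n (∣m∣n⇒∣m-n (∣m∣n⇒∣m-n N∣₄ N∣₂) N∣₁) N∣₃))
    where
    lemma : ∀ a b c d i j p m →
            (d ℤ.+ - a - + 2 ℤ.* (m ℤ.* p)) - (- b ℤ.+ c - + 2 ℤ.* (p ℤ.* m))
              - (b - (a ℤ.+ i)) - (d - (c ℤ.+ j)) ≡ i ℤ.+ j
    lemma = solve-∀

  q∣-euclid : ∀ a b → + q ∣ℤ a ℤ.* b → + q ∣ℤ a ⊎ + q ∣ℤ b
  q∣-euclid a b q∣ab = Sum.map ∣ᵤ⇒∣ ∣ᵤ⇒∣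
    (euclidsLemma ℤ.∣ a ∣ ℤ.∣ b ∣ q-prime (subst (q ℕ.∣_) (ℤ.abs-* a b) (∣⇒∣ᵤ q∣ab)))

  abscissa-≡ : ∀ {u v : V} → + q ∣ℤ abscissa u - abscissa v → abscissa u ≡ abscissa v
  abscissa-≡ {_ , x , _} {_ , x′ , _} q∣ = cong +_ (∣-diff⇒≡ (toℕ<n x) (toℕ<n x′) q∣)

  -- In the alternating sum of the four incidences all heights cancel, and the products leave twice
  -- the product of the differences of opposite abscissas. Cancelling 2 from `N = 2 * q`, the prime
  -- `q` divides one difference; those two vertices then share a neighbour and an abscissa.
  EEEE⇒≡ : ∀ {u v w x} → E u v → E v w → E w x → E x u → u ≡ w ⊎ v ≡ x
  EEEE⇒≡ {u} {v} {w} {x} uv@(_ , N∣₁) vw@(_ , N∣₂) wx@(_ , N∣₃) xu@(_ , N∣₄) =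
    Sum.map (λ q∣ → neighbour-unique {v} {u} {w} (E-sym {u} {v} uv) vw (abscissa-≡ {u} {w} q∣))
            (λ q∣ → neighbour-unique {w} {v} {x} (E-sym {v} {w} vw) wx (abscissa-≡ {v} {x} q∣))
            (q∣-euclid (abscissa u - abscissa w) (abscissa v - abscissa x)
              (*-cancelˡ-∣ (+ 2) (subst (_∣ℤ + 2 ℤ.* ((abscissa u - abscissa w) ℤ.* (abscissa v - abscissa x))) (ℤ.pos-* 2 q)
                (∣-resp (lemma (height u) (height v) (height w) (height x)
                               (abscissa u) (abscissa v) (abscissa w) (abscissa x))
                  (∣m∣n⇒∣m+n (∣m∣n⇒∣m-n N∣₂ N∣₁) (∣m∣n⇒∣m-n N∣₄ N∣₃))))))
    where
    lemma : ∀ a b c d u v w x →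
            ((b ℤ.+ c - + 2 ℤ.* (v ℤ.* w)) - (a ℤ.+ b - + 2 ℤ.* (u ℤ.* v))) ℤ.+
            ((d ℤ.+ a - + 2 ℤ.* (x ℤ.* u)) - (c ℤ.+ d - + 2 ℤ.* (w ℤ.* x)))
            ≡ + 2 ℤ.* ((u - w) ℤ.* (v - x))
    lemma = solve-∀

  -- Edges switch between points and lines and arcs do not, so the number of edges in a closed walk
  -- is even. The same reason serves `no-EEEA`.
  no-AAAE : ∀ {u v w x} → A u v → A v w → A w x → ¬ E x u
  no-AAAE (refl , _) (refl , _) (refl , _) (t , _) = Bool.not-¬ refl t

  no-EEEA : ∀ {u v w x} → E u v → E v w → E w x → ¬ A x u
  no-EEEA {false , _} (refl , _) (refl , _) (refl , _) (() , _)
  no-EEEA {true  , _} (refl , _) (refl , _) (refl , _) (() , _)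

  Adj : Rel V 0ℓ
  Adj u v = A u v ⊎ E u v

  -- Up to rotation there are six patterns of arcs and edges. Only AAEE and EEEE can close up, and
  -- they force two opposite vertices to coincide.
  no-4-cycle : ∀ {u v w x} → u ≢ w → v ≢ x → Adj u v → Adj v w → Adj w x → ¬ Adj x u
  no-4-cycle {u} {v} {w} {x} u≢w v≢x = λ where
    (inj₁ a) (inj₁ b) (inj₁ c) (inj₁ d) → no-AAAA {u} {v} {w} {x} a b c d
    (inj₁ a) (inj₁ b) (inj₁ c) (inj₂ d) → no-AAAE {u} {v} {w} {x} a b c d
    (inj₁ a) (inj₁ b) (inj₂ c) (inj₁ d) → no-AAAE {x} {u} {v} {w} d a b c
    (inj₁ a) (inj₁ b) (inj₂ c) (inj₂ d) → u≢w (AAEE⇒≡ {u} {v} {w} {x} a b c d)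
    (inj₁ a) (inj₂ b) (inj₁ c) (inj₁ d) → no-AAAE {w} {x} {u} {v} c d a b
    (inj₁ a) (inj₂ b) (inj₁ c) (inj₂ d) → no-AEAE {u} {v} {w} {x} a b c d
    (inj₁ a) (inj₂ b) (inj₂ c) (inj₁ d) → v≢x (sym (AAEE⇒≡ {x} {u} {v} {w} d a b c))
    (inj₁ a) (inj₂ b) (inj₂ c) (inj₂ d) → no-EEEA {v} {w} {x} {u} b c d a
    (inj₂ a) (inj₁ b) (inj₁ c) (inj₁ d) → no-AAAE {v} {w} {x} {u} b c d a
    (inj₂ a) (inj₁ b) (inj₁ c) (inj₂ d) → v≢x (AAEE⇒≡ {v} {w} {x} {u} b c d a)
    (inj₂ a) (inj₁ b) (inj₂ c) (inj₁ d) → no-AEAE {v} {w} {x} {u} b c d a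
    (inj₂ a) (inj₁ b) (inj₂ c) (inj₂ d) → no-EEEA {w} {x} {u} {v} c d a b
    (inj₂ a) (inj₂ b) (inj₁ c) (inj₁ d) → u≢w (sym (AAEE⇒≡ {w} {x} {u} {v} c d a b))
    (inj₂ a) (inj₂ b) (inj₁ c) (inj₂ d) → no-EEEA {x} {u} {v} {w} d a b c
    (inj₂ a) (inj₂ b) (inj₂ c) (inj₁ d) → no-EEEA {u} {v} {w} {x} a b c d
    (inj₂ a) (inj₂ b) (inj₂ c) (inj₂ d) → Sum.[ u≢w , v≢x ] (EEEE⇒≡ {u} {v} {w} {x} a b c d)

  -- Parity along arcs and edges

  bit : Bool → ℤ
  bit false = + 0
  bit true  = + 1

  parity : V → ℤ
  parity (t , _ , y) = bit t ℤ.+ + toℕ y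

  2∣N : + 2 ∣ℤ + N
  2∣N = divides (+ q) (trans (ℤ.pos-* 2 q) (ℤ.*-comm (+ 2) (+ q)))

  -- As `N` is even, a congruence modulo `N` determines parity. An arc adds an odd step; for an edge
  -- the doubled product vanishes modulo 2, so only `bit` changes.
  Adj⇒parity : ∀ {u v} → Adj u v → + 2 ∣ℤ parity v - parity u - + 1
  Adj⇒parity {t , _ , y} {_ , _ , y′} (inj₁ (refl , _ , i , N∣)) =
    ∣-resp (trans (cong (λ s → (+ toℕ y′ - (+ toℕ y ℤ.+ (+ 1 ℤ.+ s))) ℤ.+ + 2 ℤ.* + toℕ i) (ℤ.pos-* 2 (toℕ i)))
                  (lemma (bit t) (+ toℕ y) (+ toℕ y′) (+ toℕ i)))
      (∣m∣n⇒∣m+n (∣-trans 2∣N N∣) (∣m⇒∣m*n {m = + 2} (+ toℕ i) (divides (+ 1) refl)))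
    where
    lemma : ∀ t y y′ i → (y′ - (y ℤ.+ (+ 1 ℤ.+ + 2 ℤ.* i))) ℤ.+ + 2 ℤ.* i ≡ (t ℤ.+ y′) - (t ℤ.+ y) - + 1
    lemma = solve-∀
  Adj⇒parity {false , x , y} {_ , m , b} (inj₂ (refl , N∣)) =
    ∣-resp (lemma (+ toℕ y) (+ toℕ b) (+ toℕ x ℤ.* + toℕ m))
      (∣m⇒∣-m (∣m∣n⇒∣m+n (∣-trans 2∣N N∣) (∣m⇒∣m*n {m = + 2} (+ toℕ x ℤ.* + toℕ m) (divides (+ 1) refl))))
    where
    lemma : ∀ y b p → - ((y ℤ.+ - b - + 2 ℤ.* p) ℤ.+ + 2 ℤ.* p) ≡ (+ 1 ℤ.+ b) - (+ 0 ℤ.+ y) - + 1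
    lemma = solve-∀
  Adj⇒parity {true , x , y} {_ , m , b} (inj₂ (refl , N∣)) =
    ∣-resp (lemma (+ toℕ y) (+ toℕ b) (+ toℕ x ℤ.* + toℕ m))
      -- From a line to a point `bit` drops by 1; with the further `- + 1` in the claim this makes
      -- -2, which the `- + 1` next to the product supplies.
      (∣m∣n⇒∣m+n (∣-trans 2∣N N∣) (∣m⇒∣m*n {m = + 2} (+ toℕ x ℤ.* + toℕ m - + 1) (divides (+ 1) refl)))
    where
    lemma : ∀ y b p → (- y ℤ.+ b - + 2 ℤ.* p) ℤ.+ + 2 ℤ.* (p - + 1) ≡ (+ 0 ℤ.+ b) - (+ 1 ℤ.+ y) - + 1
    lemma = solve-∀

  -- The mixed graph and its girth

  order : ℕ
  order = 2 * (q * N)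

  -- Opaque, since the arguments below need only that the two maps are mutually inverse.
  opaque
    vertices : Fin order ↔ V
    vertices = (2↔Bool ×-↔ *↔×) ↔-∘ *↔×

  open Inverse vertices using (to; from; strictlyInverseˡ; strictlyInverseʳ)

  to-injective : ∀ {i j} → to i ≡ to j → i ≡ j
  to-injective eq = trans (sym (strictlyInverseʳ _)) (trans (cong from eq) (strictlyInverseʳ _))

  G : MixedGraph order
  G = record
    { arc           = λ i j → isYes (A? (to i) (to j))
    ; edge          = λ i j → isYes (E? (to i) (to j))
    ; arc-loopless  = λ i a → A-irrefl (to i) (toWitness a)
    ; edge-loopless = λ i e → E-irrefl (to i) (toWitness e)
    ; edge-sym      = λ i j e → fromWitness (E-sym {to i} {to j} (toWitness e))
    ; arc-edge      = λ i j a e → A⇒¬E {to i} {to j} (toWitness a) (toWitness e)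
    }

  open MixedGraph G using (arc; Joined)

  Joined⇒Adj : ∀ {i j} → Joined i j → Adj (to i) (to j)
  Joined⇒Adj = Sum.map toWitness toWitness

  -- After `i` steps `parity` has changed by `i` modulo 2, and the full turn returns to the start.
  cycle-parity : ∀ {k} (C : Cycle G k) → + 2 ∣ℤ + k
  cycle-parity {k} C = ∣-resp
    (trans (cong₂ (λ u l → - (parity (to u) - p₀ - + l)) closed (toℕ-fromℕ k)) (lemma₁ p₀ (+ k)))
    (∣m⇒∣-m (walk (fromℕ k)))
    where
    open Cycle C

    p₀ : ℤ
    p₀ = parity (to (vertex zero))

    lemma₁ : ∀ p k → - (p - p - k) ≡ k
    lemma₁ = solve-∀

    lemma₂ : ∀ a b p k → (a - p - k) ℤ.+ (b - a - + 1) ≡ b - p - (+ 1 ℤ.+ k)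
    lemma₂ = solve-∀

    walk : ∀ i → + 2 ∣ℤ parity (to (vertex i)) - p₀ - + toℕ i
    walk = <-weakInduction _ (divides (+ 0) (lemma₃ p₀)) λ i 2∣ →
      ∣-resp (lemma₂ (parity (to (vertex (inject₁ i)))) (parity (to (vertex (suc i)))) p₀ (+ toℕ i))
        (∣m∣n⇒∣m+n (subst (λ l → + 2 ∣ℤ parity (to (vertex (inject₁ i))) - p₀ - + l) (toℕ-inject₁ i) 2∣)
                   (Adj⇒parity {to (vertex (inject₁ i))} {to (vertex (suc i))} (Joined⇒Adj (joined i))))
      where
      lemma₃ : ∀ p → p - p - + 0 ≡ + 0
      lemma₃ = solve-∀

  no-2-cycle : ¬ Cycle G 2
  no-2-cycle C with Cycle.joined C zero | Cycle.joined C (suc zero)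
  ... | inj₂ e | _      = Cycle.no-back-and-forth C zero e refl
  ... | _      | inj₂ e = Cycle.no-back-and-forth C (suc zero) e refl
  ... | inj₁ a | inj₁ b = no-AA {to (vertex zero)} {to (vertex (suc zero))}
    (toWitness a) (toWitness (subst (λ v → T (arc (vertex (suc zero)) v)) closed b))
    where
    open Cycle C

  6≤cycle : ∀ k → Cycle G k → 6 ≤ k
  6≤cycle 0 C with () ← Cycle.length≥1 C
  6≤cycle 1 C = contradiction (cycle-parity C) (from-no (+ 2 ∣? + 1))
  6≤cycle 2 C = contradiction C no-2-cycle
  6≤cycle 3 C = contradiction (cycle-parity C) (from-no (+ 2 ∣? + 3))
  6≤cycle 4 C = contradiction
    (Joined⇒Adj (subst (Joined (vertex (suc (suc (suc zero))))) closed (joined (suc (suc (suc zero))))))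
    (no-4-cycle (λ eq → contradiction (distinct {zero} {suc (suc zero)} (to-injective eq)) λ ())
                (λ eq → contradiction (distinct {suc zero} {suc (suc (suc zero))} (to-injective eq)) λ ())
                (Joined⇒Adj (joined zero)) (Joined⇒Adj (joined (suc zero))) (Joined⇒Adj (joined (suc (suc zero)))))
    where
    open Cycle C
  6≤cycle 5 C = contradiction (cycle-parity C) (from-no (+ 2 ∣? + 5))
  6≤cycle (suc (suc (suc (suc (suc (suc k)))))) C = s≤s (s≤s (s≤s (s≤s (s≤s (s≤s z≤n)))))

  -- Four longest steps 2c + 1 and two steps 1 make one turn around ℤ/2q.
  stride : ℕ → Fin (suc c)
  stride 0 = fromℕ c
  stride 1 = fromℕ c
  stride 2 = fromℕ c
  stride 3 = fromℕ c
  stride _ = zero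

  position : ℕ → ℕ
  position zero    = 0
  position (suc k) = position k + step (stride k)

  position-mono : ∀ k → position k < position (suc k)
  position-mono k = ℕ.m<m+n (position k) (s≤s z≤n)

  position-6 : position 6 ≡ N
  position-6 = trans (cong (λ d → 0 + d + d + d + d + 1 + 1) (cong (λ c → 1 + 2 * c) (toℕ-fromℕ c))) (sym N≡)

  hexagon-vertex : ℕ → V
  hexagon-vertex k = false , fromℕ< {0} (>-nonZero⁻¹ q) , residue N (+ position k)

  hexagon-closed : hexagon-vertex 6 ≡ hexagon-vertex 0
  hexagon-closed = cong (λ y → false , fromℕ< {0} (>-nonZero⁻¹ q) , y) (residue-unique N
    (∣-resp (trans (lemma (+ toℕ (residue N (+ 0))) (+ N)) (cong (λ m → + toℕ (residue N (+ 0)) - + m) (sym position-6)))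
      (∣m∣n⇒∣m-n (residue-≡ N (+ 0)) (divides (+ 1) (sym (ℤ.*-identityˡ (+ N)))))))
    where
    lemma : ∀ r m → (r - + 0) - m ≡ r - m
    lemma = solve-∀

  hexagon-arc : ∀ k → A (hexagon-vertex k) (hexagon-vertex (suc k))
  hexagon-arc k = refl , refl , stride k ,
    ∣-resp (lemma (+ toℕ (residue N (+ position (suc k)))) (+ toℕ (residue N (+ position k))) (+ position k) (+ step (stride k)))
      (∣m∣n⇒∣m-n (residue-≡ N (+ position (suc k))) (residue-≡ N (+ position k)))
    where
    lemma : ∀ r r′ p s → (r - (p ℤ.+ s)) - (r′ - p) ≡ r - (r′ ℤ.+ s)
    lemma = solve-∀

  -- Positions increase strictly up to `position 6`, which is `N`; the first six are therefore
  -- different numbers below `N` and remain different as residues.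
  hexagon-distinct : ∀ {k l} → k < 6 → l < 6 → hexagon-vertex k ≡ hexagon-vertex l → k ≡ l
  hexagon-distinct {k} {l} k<6 l<6 eq = strictlyMono⇒injective position-mono
    (∣-diff⇒≡ (bound k<6) (bound l<6) (residue-injective N (cong (proj₂ ∘ proj₂) eq)))
    where
    bound : ∀ {k} → k < 6 → position k < N
    bound {k} k<6 = subst (position k <_) position-6 (strictlyMono position-mono k<6)

  hexagon : Cycle G 6
  hexagon = record
    { length≥1          = s≤s z≤n
    ; vertex            = vertex
    ; closed            = cong from hexagon-closed
    ; distinct          = λ {i} {j} eq → toℕ-injective (hexagon-distinct (toℕ<n i) (toℕ<n j)
                            (subst₂ (λ k l → hexagon-vertex k ≡ hexagon-vertex l) (toℕ-inject₁ i) (toℕ-inject₁ j)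
                              (from-injective eq)))
    ; joined            = λ i → inj₁ (fromWitness (subst₂ A (sym (strictlyInverseˡ _)) (sym (strictlyInverseˡ _))
                            (subst (λ k → A (hexagon-vertex k) (hexagon-vertex (suc (toℕ i)))) (sym (toℕ-inject₁ i))
                              (hexagon-arc (toℕ i)))))
    ; no-back-and-forth = λ _ _ ()
    }
    where
    vertex : Fin 7 → Fin order
    vertex i = from (hexagon-vertex (toℕ i))

    from-injective : ∀ {u v} → from u ≡ from v → u ≡ v
    from-injective eq = trans (sym (strictlyInverseˡ _)) (trans (cong to eq) (strictlyInverseˡ _))

  G-isMixedGraph : Is[ suc c , q ⨾ 6 ]-MixedGraph G
  G-isMixedGraph = record
    { indegree≡z   = λ v → ∣tabulate∣-↔ vertices (λ u → A? u (to v)) (inNeighbours (to v))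
    ; outdegree≡z  = λ v → ∣tabulate∣-↔ vertices (A? (to v)) (outNeighbours (to v))
    ; edgedegree≡r = λ v → ∣tabulate∣-↔ vertices (E? (to v)) (edgeNeighbours (to v))
    ; girth≡g      = hexagon , 6≤cycle
    }


-- Arithmetic of the parameters and the bound

2∤prime : ∀ {q} → Prime q → q ≥ 3 → ¬ (2 ℕ.∣ q)
2∤prime q-prime q≥3 2∣q with prime⇒irreducible q-prime 2∣q
... | inj₂ refl = contradiction q≥3 λ { (s≤s (s≤s ())) }

¬2∣⇒odd : ∀ m → ¬ (2 ℕ.∣ m) → m ≡ 1 + m / 2 * 2
¬2∣⇒odd m 2∤m with m % 2 | m%n<n m 2 | m≡m%n+[m/n]*n m 2
... | 0 | _ | m≡ = contradiction (ℕ.divides (m / 2) m≡) 2∤m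
... | 1 | _ | m≡ = m≡
... | suc (suc _) | s≤s (s≤s ()) | _

corollary6 : (q : ℕ) → Prime q → q ≥ 3 →
    let p = (q ∸ 1) / 2 in
    ¬ (2 ∣ p) →
    ∃ λ n → IsMinimumOrder[ (p + 1) / 2 , q ⨾ 6 ] n × n ≤ 4 * q ^ 2
corollary6 q q-prime q≥3 2∤p =
  minimumOrder (4 * q ^ 2)
    (subst₂ (λ z n → IsOrder[ z , q ⨾ 6 ] n) (sym z≡) order≡ (G , G-isMixedGraph))
  where
  open ≡-Reasoning

  p c : ℕ
  p = (q ∸ 1) / 2
  c = p / 2

  p≡1+2c : p ≡ 1 + c * 2
  p≡1+2c = ¬2∣⇒odd p 2∤p

  q≡1+2p : q ≡ 1 + p * 2
  q≡1+2p = begin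
    q              ≡⟨ q-odd ⟩
    1 + q / 2 * 2  ≡⟨ cong (λ m → 1 + m * 2) (m*n/n≡m (q / 2) 2) ⟨
    -- The inner `q / 2 * 2` is by computation `(1 + q / 2 * 2) ∸ 1`, which `q-odd` turns into the
    -- `q ∸ 1` of `p`.
    1 + q / 2 * 2 / 2 * 2  ≡⟨ cong (λ m → 1 + (m ∸ 1) / 2 * 2) q-odd ⟨
    1 + p * 2      ∎
    where
    q-odd : q ≡ 1 + q / 2 * 2
    q-odd = ¬2∣⇒odd q (2∤prime q-prime q≥3)

  q≡3+4c : q ≡ 3 + 4 * c
  q≡3+4c = begin
    q                    ≡⟨ q≡1+2p ⟩
    1 + p * 2            ≡⟨ cong (λ m → 1 + m * 2) p≡1+2c ⟩
    1 + (1 + c * 2) * 2  ≡⟨ lemma c ⟩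
    3 + 4 * c            ∎
    where
    lemma : ∀ c → 1 + (1 + c * 2) * 2 ≡ 3 + 4 * c
    lemma = ℕ.solve-∀

  z≡ : (p + 1) / 2 ≡ suc c
  z≡ = begin
    -- Since `p` is odd, `p + 1` is twice `suc c`, so the division is exact and gives the number of
    -- step lengths.
    (p + 1) / 2      ≡⟨ cong (_/ 2) (trans (ℕ.+-comm p 1) (cong suc p≡1+2c)) ⟩
    suc c * 2 / 2    ≡⟨ m*n/n≡m (suc c) 2 ⟩
    suc c            ∎

  open Construction q c q≡3+4c q-prime using (order; G; G-isMixedGraph)

  order≡ : order ≡ 4 * q ^ 2
  order≡ = lemma q
    where
    -- The right-hand side is `4 * q ^ 2` with the power unfolded.
    lemma : ∀ q → 2 * (q * (2 * q)) ≡ 4 * (q * (q * 1))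
    lemma = ℕ.solve-∀
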